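{- If $G$ is a $\mathcal{T}_2$-graph, then the $4$-independence complex $\mathrm{Ind}_4(G)$ is shellable.
   Context: All graphs are finite and simple. A block of a graph is a maximal connected subgraph that remains connected after removal of any single vertex; $G$ is a block graph if every block is a complete graph (a clique). An $n$-clique path $\mathrm{CP}(B_1,\dots,B_n)$ ($n\ge 1$) is a graph consisting of cliques $B_1,\dots,B_n$ arranged linearly, where each consecutive pair $B_i, B_{i+1}$ shares exactly one vertex $x_i$; $x_1,\dots,x_{n-1}$ are its connecting vertices. A connected graph $H$ is a $\mathcal{T}_2$-graph if it is a block graph and contains a clique-path subgraph $P = \mathrm{CP}(B_1,\dots,B_n)$, $n \ge 1$, of maximum length, with connecting vertices $x_i \in B_i \cap B_{i+1}$ ($1 \le i \le n-1$), such that every clique (block) $K$ of $H$ not belonging to $P$ satisfies one of: (1) $V(K)\cap V(P) = \{x_i\}$ for some $1 \le i \le n-1$; or (2) $V(K)\cap V(P) = \emptyset$ and there is a clique $K'$ of $H$ satisfying (1) with $V(K)\cap V(K') = \{y\}$ for some vertex $y$. A graph is a $\mathcal{T}_2$-graph if each of its connected components is. For $r \geq 1$, a subset $A \subseteq V(G)$ is $r$-independent if every connected component of $G[A]$ has at most $r$ vertices; $\mathrm{Ind}_r(G)$ is the simplicial complex on $V(G)$ of all $r$-independent subsets. A (not necessarily pure) simplicial complex is shellable if its facets can be ordered $F_1,\dots,F_t$ so that for each $k>1$, $\langle F_k\rangle \cap \langle F_1,\dots,F_{k-1}\rangle$ is pure of dimension $\dim F_k-1$ ($\langle\mathcal F\rangle$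 = complex generated by $\mathcal F$). -}

module Defs where

open import Data.Bool using (Bool; true; false; T)
open import Data.Nat using (ℕ; zero; suc; _≤_; _<_; _∸_)
open import Data.Fin using (Fin)
open import Data.Fin.Subset
  using (Subset; _∈_; _⊆_; _∩_; _∪_; ⁅_⁆; ∣_∣; _-_)
  renaming (⊥ to ∅)
open import Data.List using (List; []; _∷_; _++_; length)
open import Data.List.Relation.Unary.All using (All)
open import Data.List.Relation.Unary.Any using (Any)
open import Data.List.Relation.Unary.Unique.Propositional using (Unique)
import Data.List.Membership.Propositional as LM
open import Data.Product using (Σ; ∃; _×_)
open import Data.Sum using (_⊎_)
open import Relation.Binary.PropositionalEquality using (_≡_; _≢_)
open import Relation.Nullary using (¬_)

record Graph : Set where
  field
    n      : ℕ
    adj    : Fin n → Fin n → Bool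
    sym    : ∀ u v → adj u v ≡ adj v u
    irrefl : ∀ v → adj v v ≡ false
open Graph public

Edge : (G : Graph) → Fin (n G) → Fin (n G) → Set
Edge G u v = T (adj G u v)

data Walk (G : Graph) (S : Subset (n G)) : Fin (n G) → Fin (n G) → Set where
  here : ∀ {v} → v ∈ S → Walk G S v v
  step : ∀ {u w v} → u ∈ S → Edge G u w → Walk G S w v → Walk G S u v

-- G[S] is connected (the empty vertex set counts as connected).
ConnectedIn : (G : Graph) → Subset (n G) → Set
ConnectedIn G S = ∀ u v → u ∈ S → v ∈ S → Walk G S u v

Clique : (G : Graph) → Subset (n G) → Set
Clique G S = ∀ u v → u ∈ S → v ∈ S → u ≢ v → Edge G u v

IsComponent : (G : Graph) → Subset (n G) → Set
IsComponent G W =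
  (∃ λ v → v ∈ W) × ConnectedIn G W × (∀ u v → u ∈ W → Edge G u v → v ∈ W)

Nonseparable : (G : Graph) → Subset (n G) → Set
Nonseparable G S = ConnectedIn G S × (∀ v → v ∈ S → ConnectedIn G (S - v))

-- S is a block of the induced subgraph G[W]  (maximal nonseparable subgraph;
-- maximal ones are automatically induced, so vertex sets suffice).
BlockIn : (G : Graph) → Subset (n G) → Subset (n G) → Set
BlockIn G W S =
  S ⊆ W × Nonseparable G S ×
  (∀ T → T ⊆ W → S ⊆ T → Nonseparable G T → T ≡ S)

-- Clique paths CP(B_0,...,B_{len-1}) in G[W] made of blocks of G[W].
-- (0-based indexing: connecting vertex x i ∈ B i ∩ B (i+1) for i+1 < len.)

record CliquePath (G : Graph) (W : Subset (n G)) : Set where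
  field
    len       : ℕ
    len≥1     : 1 ≤ len
    B         : ℕ → Subset (n G)
    x         : ℕ → Fin (n G)
    B-block   : ∀ i → i < len → BlockIn G W (B i)
    B-consec  : ∀ i → suc i < len → B i ∩ B (suc i) ≡ ⁅ x i ⁆
    B-far     : ∀ i j → j < len → suc i < j → B i ∩ B j ≡ ∅
open CliquePath public

unionUpTo : ∀ {m} → (ℕ → Subset m) → ℕ → Subset m
unionUpTo B zero    = ∅
unionUpTo B (suc k) = unionUpTo B k ∪ B k

VP : ∀ {G W} → CliquePath G W → Subset (n G)
VP P = unionUpTo (B P) (len P)

Cond1 : ∀ {G W} → CliquePath G W → Subset (n G) → Set
Cond1 P K = ∃ λ i → suc i < len P × K ∩ VP P ≡ ⁅ x P i ⁆

IsT2On : (G : Graph) → Subset (n G) → Set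
IsT2On G W =
  ConnectedIn G W ×
  (∀ S → BlockIn G W S → Clique G S) ×
  Σ (CliquePath G W) λ P →
    (∀ (Q : CliquePath G W) → len Q ≤ len P) ×
    (∀ K → BlockIn G W K → (∀ i → i < len P → K ≢ B P i) →
       Cond1 P K ⊎
       (K ∩ VP P ≡ ∅ ×
        ∃ λ K' → BlockIn G W K' × Cond1 P K' × ∃ λ y → K ∩ K' ≡ ⁅ y ⁆))

T2Graph : Graph → Set
T2Graph G = ∀ W → IsComponent G W → IsT2On G W

-- every connected component of G[A] has at most r vertices
RIndependent : (G : Graph) → ℕ → Subset (n G) → Set
RIndependent G r A =
  ∀ v → v ∈ A → (xs : List (Fin (n G))) → Unique xs →
    All (Walk G A v) xs → length xs ≤ r

-- simplicial complexes on Fin m, given by their set of faces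
Complex : ℕ → Set₁
Complex m = Subset m → Set

Ind : (G : Graph) → ℕ → Complex (n G)
Ind G r = RIndependent G r

IsFacet : ∀ {m} → Complex m → Subset m → Set
IsFacet Δ σ = Δ σ × (∀ τ → Δ τ → σ ⊆ τ → τ ≡ σ)

-- pure, all facets having cardinality c (i.e. dimension c - 1)
PureCard : ∀ {m} → Complex m → ℕ → Set
PureCard Δ c = ∀ σ → IsFacet Δ σ → ∣ σ ∣ ≡ c

MeetComplex : ∀ {m} → Subset m → List (Subset m) → Complex m
MeetComplex F Fs σ = σ ⊆ F × Any (σ ⊆_) Fs

-- Shellable: the facets can be listed (each exactly once) as F_1,...,F_t such
-- that for k > 1, ⟨F_k⟩ ∩ ⟨F_1,...,F_{k-1}⟩ is pure of dimension dim F_k - 1,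
-- i.e. all its facets have cardinality |F_k| - 1.
Shellable : ∀ {m} → Complex m → Set
Shellable Δ =
  Σ (List (Subset _)) λ Fs →
    Unique Fs ×
    (∀ F → IsFacet Δ F → F LM.∈ Fs) ×
    (∀ F → F LM.∈ Fs → IsFacet Δ F) ×
    (∀ pre F post → Fs ≡ pre ++ F ∷ post → pre ≢ [] →
       PureCard (MeetComplex F pre) (∣ F ∣ ∸ 1))

{-# OPTIONS --safe #-}

-- The statement holds for every r and every graph whose blocks are cliques, and
-- the complex is even vertex decomposable.  Consider the faces σ with
-- I ⊆ σ ⊆ V, where V itself is not a face, and let X be a component of G[V]
-- with more than r vertices, rooted anywhere.  For v ∈ X let D v be the set of
-- vertices of X that v separates from the root, v included.  A vertex v ∈ V ∖ I
-- sheds if in every face containing v it can be exchanged for a new vertex w.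
-- Call v ∈ X ∖ I big if |D v| > r.
--
-- If the vertices of X that are not big span no connected set M with |M| > r,
-- a big v with |D v| least sheds: a face misses some w ∈ D v, and without v the
-- component of w stays among the other vertices of D v, none of them big.
--
-- Otherwise v ∈ M ∖ I with |D v| greatest sheds.  If a face misses some
-- w ∈ D v, that w will do.  If not, let w ∈ M be a new neighbour of the
-- component of v in the face; exchanging v for w loses all of D v, and gains
-- only vertices of D w, since in a block graph the neighbours of w on the side
-- of the root are pairwise adjacent.

module Submission where

open import Defs

open import Data.Bool using (T)
open import Data.Bool.Properties using (T?)
open import Data.Empty using (⊥; ⊥-elim)
open import Data.Fin using (Fin; zero; suc)
open import Data.Fin.Properties using (_≟_; any?; all?)
open import Data.Fin.Subset
  using (Subset; inside; outside; _∈_; _∉_; _⊆_; _∩_; _∪_; ∁; _─_; _-_; ⁅_⁆; ∣_∣)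
  renaming (⊥ to ∅; ⊤ to full)
open import Data.Fin.Subset.Properties
open import Data.List using (List; []; _∷_; _++_; length; filter; allFin)
open import Data.List.Extrema.Nat
  using (argmax; argmin; argmax-all; argmin-all; f[xs]≤f[argmax]; f[argmin]≤f[xs])
import Data.List.Membership.Propositional as LM
open import Data.List.Membership.Propositional.Properties
  using (∈-++⁺ˡ; ∈-++⁺ʳ; ∈-++⁻; ∈-filter⁺; ∈-allFin)
open import Data.List.Properties using (∷-injective)
open import Data.List.Relation.Unary.All as All using (All; []; _∷_)
import Data.List.Relation.Unary.All.Properties as Allₚ
import Data.List.Relation.Unary.AllPairs as AllPairs
open import Data.List.Relation.Unary.Any using (here; there)
open import Data.List.Relation.Unary.Unique.Propositional using (Unique)
import Data.List.Relation.Unary.Unique.Propositional.Properties as Uniqueₚ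
open import Data.Nat using (ℕ; zero; suc; _+_; _∸_; _≤_; _<_; z≤n; s≤s; _<?_)
import Data.Nat.Properties as ℕₚ
open import Data.Product using (∃; _×_; _,_; proj₁; proj₂)
open import Data.Sum using (_⊎_; inj₁; inj₂; [_,_]′)
open import Data.Vec using ([]; _∷_; here; there; tabulate)
open import Data.Vec.Properties using (lookup∘tabulate; lookup⇒[]=; []=⇒lookup)
open import Function using (_∘_)
open import Relation.Binary.PropositionalEquality
  using (_≡_; _≢_; refl; trans; cong; subst) renaming (sym to ≡-sym)
open import Relation.Nullary using (¬_; Dec; yes; no; does; contradiction)
open import Relation.Nullary.Decidable
  using (_×-dec_; _→-dec_; ¬?; map′; dec-true; decidable-stable)
open import Relation.Unary using (Decidable)

-- Cardinalities of finite subsets, extremal elements and list splitting.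

private
  variable
    m : ℕ

x∈p─q⇒x∉q : ∀ (p q : Subset m) {x} → x ∈ p ─ q → x ∉ q
x∈p─q⇒x∉q (inside ∷ p) (outside ∷ q) here ()
x∈p─q⇒x∉q (_ ∷ p) (_ ∷ q) (there x∈) (there x∈q) = x∈p─q⇒x∉q p q x∈ x∈q

x∈p-y⇒x≢y : ∀ (p : Subset m) {x y} → x ∈ p - y → x ≢ y
x∈p-y⇒x≢y p {y = y} x∈ refl = x∈p─q⇒x∉q p ⁅ y ⁆ x∈ (x∈⁅x⁆ y)

p-x⊆p : ∀ (p : Subset m) x → p - x ⊆ p
p-x⊆p p x = p─q⊆p p ⁅ x ⁆

p∪x⊆q : ∀ {p q : Subset m} {x} → p ⊆ q → x ∈ q → p ∪ ⁅ x ⁆ ⊆ q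
p∪x⊆q {p = p} {q} {x} p⊆q x∈q y∈ with x∈p∪q⁻ p ⁅ x ⁆ y∈
... | inj₁ y∈p = p⊆q y∈p
... | inj₂ y∈x = subst (_∈ q) (≡-sym (x∈⁅y⁆⇒x≡y x y∈x)) x∈q

p-x⊆q-x : ∀ {p q : Subset m} {x} → p ⊆ q → p - x ⊆ q - x
p-x⊆q-x {p = p} {x = x} p⊆q y∈ = x∈p∧x≢y⇒x∈p-y (p⊆q (p-x⊆p p x y∈)) (x∈p-y⇒x≢y p y∈)

p⊆q-x : ∀ {p q : Subset m} {x} → p ⊆ q → x ∉ p → p ⊆ q - x
p⊆q-x p⊆q x∉p y∈p = x∈p∧x≢y⇒x∈p-y (p⊆q y∈p) λ { refl → x∉p y∈p }

x∈p∪x : ∀ (p : Subset m) x → x ∈ p ∪ ⁅ x ⁆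
x∈p∪x p x = q⊆p∪q p ⁅ x ⁆ (x∈⁅x⁆ x)

∣p∣≤1+∣p-x∣ : ∀ (p : Subset m) x → ∣ p ∣ ≤ suc ∣ p - x ∣
∣p∣≤1+∣p-x∣ (inside  ∷ p) zero    = s≤s (ℕₚ.≤-reflexive (cong ∣_∣ (≡-sym (p─⊥≡p p))))
∣p∣≤1+∣p-x∣ (outside ∷ p) zero    = ℕₚ.m≤n⇒m≤1+n (ℕₚ.≤-reflexive (cong ∣_∣ (≡-sym (p─⊥≡p p))))
∣p∣≤1+∣p-x∣ (inside  ∷ p) (suc x) = s≤s (∣p∣≤1+∣p-x∣ p x)
∣p∣≤1+∣p-x∣ (outside ∷ p) (suc x) = ∣p∣≤1+∣p-x∣ p x

∣p-x∣≡∣p∣∸1 : ∀ (p : Subset m) {x} → x ∈ p → ∣ p - x ∣ ≡ ∣ p ∣ ∸ 1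
∣p-x∣≡∣p∣∸1 p {x} x∈p =
  ℕₚ.≤-antisym (ℕₚ.∸-monoˡ-≤ 1 (x∈p⇒∣p-x∣<∣p∣ x∈p)) (ℕₚ.∸-monoˡ-≤ 1 (∣p∣≤1+∣p-x∣ p x))

∣p∪q∣≤∣p∣+∣q∣ : ∀ (p q : Subset m) → ∣ p ∪ q ∣ ≤ ∣ p ∣ + ∣ q ∣
∣p∪q∣≤∣p∣+∣q∣ []            []            = z≤n
∣p∪q∣≤∣p∣+∣q∣ (inside  ∷ p) (inside  ∷ q) =
  s≤s (ℕₚ.≤-trans (∣p∪q∣≤∣p∣+∣q∣ p q) (ℕₚ.+-monoʳ-≤ ∣ p ∣ (ℕₚ.n≤1+n ∣ q ∣)))
∣p∪q∣≤∣p∣+∣q∣ (inside  ∷ p) (outside ∷ q) = s≤s (∣p∪q∣≤∣p∣+∣q∣ p q)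
∣p∪q∣≤∣p∣+∣q∣ (outside ∷ p) (inside  ∷ q) rewrite ℕₚ.+-suc ∣ p ∣ ∣ q ∣ =
  s≤s (∣p∪q∣≤∣p∣+∣q∣ p q)
∣p∪q∣≤∣p∣+∣q∣ (outside ∷ p) (outside ∷ q) = ∣p∪q∣≤∣p∣+∣q∣ p q

∣q∣+∣p∩∁q∣≤∣p∣ : ∀ {p q : Subset m} → q ⊆ p → ∣ q ∣ + ∣ p ∩ ∁ q ∣ ≤ ∣ p ∣
∣q∣+∣p∩∁q∣≤∣p∣ {p = []}          {[]}          _   = z≤n
∣q∣+∣p∩∁q∣≤∣p∣ {p = inside  ∷ p} {inside  ∷ q} q⊆p = s≤s (∣q∣+∣p∩∁q∣≤∣p∣ (drop-∷-⊆ q⊆p))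
∣q∣+∣p∩∁q∣≤∣p∣ {p = outside ∷ p} {inside  ∷ q} q⊆p with () ← q⊆p here
∣q∣+∣p∩∁q∣≤∣p∣ {p = inside  ∷ p} {outside ∷ q} q⊆p rewrite ℕₚ.+-suc ∣ q ∣ ∣ p ∩ ∁ q ∣ =
  s≤s (∣q∣+∣p∩∁q∣≤∣p∣ (drop-∷-⊆ q⊆p))
∣q∣+∣p∩∁q∣≤∣p∣ {p = outside ∷ p} {outside ∷ q} q⊆p = ∣q∣+∣p∩∁q∣≤∣p∣ (drop-∷-⊆ q⊆p)

module _ {P : Fin m → Set} (P? : Decidable P) where

  ⟪_⟫ : Subset m
  ⟪_⟫ = tabulate (does ∘ P?)

  ∈⟪⟫⁺ : ∀ {x} → P x → x ∈ ⟪_⟫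
  ∈⟪⟫⁺ {x} Px = lookup⇒[]= x _ (trans (lookup∘tabulate _ x) (dec-true (P? x) Px))

  ∈⟪⟫⁻ : ∀ {x} → x ∈ ⟪_⟫ → P x
  ∈⟪⟫⁻ {x} x∈ with P? x | trans (≡-sym (lookup∘tabulate (does ∘ P?) x)) ([]=⇒lookup x∈)
  ... | yes Px | _ = Px
  ... | no _   | ()

⊈⇒∃ : ∀ (p q : Subset m) → ¬ p ⊆ q → ∃ λ x → x ∈ p × x ∉ q
⊈⇒∃ p q p⊈q with any? (λ x → x ∈? p ×-dec ¬? (x ∈? q))
... | yes found = found
... | no  none  = contradiction
  (λ {x} x∈p → decidable-stable (x ∈? q) λ x∉q → none (x , x∈p , x∉q)) p⊈q

-- With `covering⇒∣p∣≤length` this turns the bounds on lists in `RIndependent` into bounds on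
-- cardinalities of subsets.
unique⇒length≤ : ∀ (p : Subset m) {xs} → Unique xs → All (_∈ p) xs → length xs ≤ ∣ p ∣
unique⇒length≤ p AllPairs.[] [] = z≤n
unique⇒length≤ p {x ∷ xs} (x∉xs AllPairs.∷ xs!) (x∈p ∷ xs⊆p) = ℕₚ.≤-trans
  (s≤s (unique⇒length≤ (p - x) xs!
    (All.zipWith (λ (x≢y , y∈p) → x∈p∧x≢y⇒x∈p-y y∈p (x≢y ∘ ≡-sym)) (x∉xs , xs⊆p))))
  (x∈p⇒∣p-x∣<∣p∣ x∈p)

covering⇒∣p∣≤length : ∀ (p : Subset m) xs → (∀ {x} → x ∈ p → x LM.∈ xs) → ∣ p ∣ ≤ length xs
covering⇒∣p∣≤length {m} p [] p⊆[] = ℕₚ.≤-reflexive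
  (trans (cong ∣_∣ (Empty-unique λ (x , x∈p) → case-[] (p⊆[] x∈p))) (∣⊥∣≡0 m))
  where
  case-[] : ∀ {x : Fin m} → ¬ x LM.∈ []
  case-[] ()
covering⇒∣p∣≤length p (x ∷ xs) p⊆ = ℕₚ.≤-trans (∣p∣≤1+∣p-x∣ p x)
  (s≤s (covering⇒∣p∣≤length (p - x) xs λ y∈ → tail y∈ (p⊆ (p-x⊆p p x y∈))))
  where
  tail : ∀ {y} → y ∈ p - x → y LM.∈ x ∷ xs → y LM.∈ xs
  tail y∈ (here refl) = contradiction refl (x∈p-y⇒x≢y p y∈)
  tail _  (there y∈)  = y∈

module _ {m} (f : Fin m → ℕ) where

  maximum-on : ∀ (p : Subset m) {x} → x ∈ p → ∃ λ y → y ∈ p × ∀ {z} → z ∈ p → f z ≤ f y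
  maximum-on p {x} x∈p = argmax f x xs
    , argmax-all f x∈p (Allₚ.all-filter (_∈? p) (allFin m))
    , λ z∈p → All.lookup (f[xs]≤f[argmax] x xs) (∈-filter⁺ (_∈? p) (∈-allFin _) z∈p)
    where xs = filter (_∈? p) (allFin m)

  minimum-on : ∀ (p : Subset m) {x} → x ∈ p → ∃ λ y → y ∈ p × ∀ {z} → z ∈ p → f y ≤ f z
  minimum-on p {x} x∈p = argmin f x xs
    , argmin-all f x∈p (Allₚ.all-filter (_∈? p) (allFin m))
    , λ z∈p → All.lookup (f[argmin]≤f[xs] x xs) (∈-filter⁺ (_∈? p) (∈-allFin _) z∈p)
    where xs = filter (_∈? p) (allFin m)

module _ {a} {A : Set a} where

  -- Tells whether a facet in a glued shelling order comes from the deletion or from the link; in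
  -- the second case all facets of the deletion precede it.
  ++-split : ∀ (xs : List A) {ys} pre {z post} → xs ++ ys ≡ pre ++ z ∷ post →
    (∃ λ zs → xs ≡ pre ++ z ∷ zs) ⊎
    (∃ λ pre′ → pre ≡ xs ++ pre′ × ys ≡ pre′ ++ z ∷ post)
  ++-split []       pre       eq = inj₂ (pre , refl , eq)
  ++-split (x ∷ xs) []        eq with refl , _ ← ∷-injective eq = inj₁ (xs , refl)
  ++-split (x ∷ xs) (p ∷ pre) eq with refl , eq′ ← ∷-injective eq
    with ++-split xs pre eq′
  ... | inj₁ (zs , refl)          = inj₁ (zs , refl)
  ... | inj₂ (pre′ , refl , refl) = inj₂ (pre′ , refl , refl)

-- Vertex decomposability

-- The pair I ⊆ V stands for the faces σ with I ⊆ σ ⊆ V, i.e. for the link of I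
-- in the complex induced on V; each face is recorded together with I.
module VertexDecomposable {m} (Δ : Complex m) (Δ? : Decidable Δ)
  (Δ-⊆ : ∀ {σ τ} → σ ⊆ τ → Δ τ → Δ σ) where

  -- The exchange form of the usual condition that no face of the link of `v` is a facet of its
  -- deletion.
  Shedding : Subset m → Subset m → Fin m → Set
  Shedding I V v = ∀ σ → I ⊆ σ → σ ⊆ V → v ∈ σ → Δ σ →
    ∃ λ w → w ∈ V × w ∉ σ × Δ ((σ - v) ∪ ⁅ w ⁆)

  record Maximal (I V F : Subset m) : Set where
    field
      above   : I ⊆ F
      below   : F ⊆ V
      face    : Δ F
      maximal : ∀ {τ} → F ⊆ τ → τ ⊆ V → Δ τ → τ ⊆ F
  open Maximal

  -- `shells` is the pointwise shelling condition: `F ∩ E` lies in the codimension-one face `F - x`,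
  -- which an earlier facet contains. `cover` speaks of all faces because gluing applies it to
  -- `F - v`, which may fail to be a facet of the deletion.
  record Shelling (I V : Subset m) : Set where
    field
      facets : List (Subset m)
      unique : Unique facets
      sound  : ∀ {F} → F LM.∈ facets → Maximal I V F
      cover  : ∀ {σ} → I ⊆ σ → σ ⊆ V → Δ σ → ∃ λ F → F LM.∈ facets × σ ⊆ F
      shells : ∀ pre {F post} → facets ≡ pre ++ F ∷ post → ∀ {E} → E LM.∈ pre →
        ∃ λ x → x ∈ F × x ∉ E × ∃ λ K → K LM.∈ pre × F - x ⊆ K
  open Shelling

  void : ∀ {I V} → ¬ Δ I → Shelling I V
  void ¬ΔI .facets = []
  void ¬ΔI .unique = AllPairs.[]
  void ¬ΔI .sound ()
  void ¬ΔI .cover I⊆σ _ Δσ = contradiction (Δ-⊆ I⊆σ Δσ) ¬ΔI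
  void ¬ΔI .shells [] ()
  void ¬ΔI .shells (_ ∷ _) ()

  simplex : ∀ {I V} → I ⊆ V → Δ V → Shelling I V
  simplex {V = V} I⊆V ΔV .facets = V ∷ []
  simplex I⊆V ΔV .unique = [] AllPairs.∷ AllPairs.[]
  simplex I⊆V ΔV .sound (here refl) = record
    { above = I⊆V ; below = λ x∈ → x∈ ; face = ΔV ; maximal = λ _ τ⊆V _ → τ⊆V }
  simplex {V = V} I⊆V ΔV .cover _ σ⊆V _ = V , here refl , σ⊆V
  simplex I⊆V ΔV .shells [] _ ()
  simplex I⊆V ΔV .shells (_ ∷ []) ()
  simplex I⊆V ΔV .shells (_ ∷ _ ∷ _) ()

  module _ {I V v} (v∈V : v ∈ V) (v∉I : v ∉ I) (shedding : Shedding I V v)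
    (deletion : Shelling I (V - v)) (link : Shelling (I ∪ ⁅ v ⁆) V) where

    private
      module Del = Shelling deletion
      module Lk  = Shelling link

      v∉deletion : ∀ {F} → F LM.∈ Del.facets → v ∉ F
      v∉deletion F∈ v∈F = x∈p-y⇒x≢y V (Del.sound F∈ .below v∈F) refl

      v∈link : ∀ {F} → F LM.∈ Lk.facets → v ∈ F
      v∈link F∈ = Lk.sound F∈ .above (x∈p∪x I v)

      -- If `v` could be added to `F`, exchanging it for `w` would enlarge `F` inside the deletion,
      -- against its maximality there.
      soundᵈ : ∀ {F} → F LM.∈ Del.facets → Maximal I V F
      soundᵈ {F} F∈ = record
        { above = F-max .above
        ; below = λ x∈ → p-x⊆p V v (F-max .below x∈)
        ; face = F-max .face
        ; maximal = λ {τ} → F-maximal {τ}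
        }
        where
        F-max = Del.sound F∈
        F-maximal : ∀ {τ} → F ⊆ τ → τ ⊆ V → Δ τ → τ ⊆ F
        F-maximal {τ} F⊆τ τ⊆V Δτ with v ∈? τ
        ... | no v∉τ = F-max .maximal F⊆τ (p⊆q-x τ⊆V v∉τ) Δτ
        ... | yes v∈τ
          with w , w∈V , w∉F∪v , Δσ′ ← shedding (F ∪ ⁅ v ⁆)
            (λ x∈I → p⊆p∪q ⁅ v ⁆ (F-max .above x∈I))
            (p∪x⊆q (λ x∈F → τ⊆V (F⊆τ x∈F)) v∈V)
            (x∈p∪x F v)
            (Δ-⊆ (p∪x⊆q F⊆τ v∈τ) Δτ)
          = contradiction (p⊆p∪q ⁅ v ⁆ (F-max .maximal (p⊆p∪q ⁅ w ⁆)
              (p∪x⊆q (F-max .below)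
                 (x∈p∧x≢y⇒x∈p-y w∈V λ { refl → w∉F∪v (x∈p∪x F v) }))
              (Δ-⊆ (p∪x⊆q F⊆σ′ (x∈p∪x _ w)) Δσ′) (x∈p∪x F w))) w∉F∪v
          where
          F⊆σ′ : ∀ {w} → F ⊆ ((F ∪ ⁅ v ⁆) - v) ∪ ⁅ w ⁆
          F⊆σ′ {w} x∈F = p⊆p∪q ⁅ w ⁆ (p⊆q-x (p⊆p∪q ⁅ v ⁆) (v∉deletion F∈) x∈F)

      soundˡ : ∀ {F} → F LM.∈ Lk.facets → Maximal I V F
      soundˡ F∈ = record
        { above = λ x∈ → F-max .above (p⊆p∪q ⁅ v ⁆ x∈)
        ; below = F-max .below ; face = F-max .face ; maximal = F-max .maximal }
        where F-max = Lk.sound F∈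

    glue : Shelling I V
    glue .facets = Del.facets ++ Lk.facets
    glue .unique = Uniqueₚ.++⁺ Del.unique Lk.unique λ (F∈ , F∈′) → v∉deletion F∈ (v∈link F∈′)
    glue .sound F∈ with ∈-++⁻ Del.facets F∈
    ... | inj₁ F∈ᵈ = soundᵈ F∈ᵈ
    ... | inj₂ F∈ˡ = soundˡ F∈ˡ
    glue .cover {σ} I⊆σ σ⊆V Δσ with v ∈? σ
    ... | no v∉σ with F , F∈ , σ⊆F ← Del.cover I⊆σ (p⊆q-x σ⊆V v∉σ) Δσ
         = F , ∈-++⁺ˡ F∈ , σ⊆F
    ... | yes v∈σ with F , F∈ , σ⊆F ← Lk.cover (p∪x⊆q I⊆σ v∈σ) σ⊆V Δσ
         = F , ∈-++⁺ʳ Del.facets F∈ , σ⊆F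
    glue .shells pre {F} {post} eq {E} E∈ with ++-split Del.facets pre eq
    ... | inj₁ (zs , eq′) = Del.shells pre eq′ E∈
    ... | inj₂ (pre′ , refl , eq′) with ∈-++⁻ Del.facets E∈
    ...   | inj₂ E∈pre′
           with x , x∈F , x∉E , K , K∈ , F-x⊆K ← Lk.shells pre′ eq′ E∈pre′
           = x , x∈F , x∉E , K , ∈-++⁺ʳ Del.facets K∈ , F-x⊆K
    -- A deletion facet `E` misses `v`, so `x = v` works: `F - v` is a face of the deletion and
    -- extends to one of its facets, all of which precede `F`.
    ...   | inj₁ E∈ᵈ with F∈ ← subst (F LM.∈_) (≡-sym eq′) (∈-++⁺ʳ pre′ (here refl))
           with K , K∈ , F-v⊆K ← Del.cover
             (p⊆q-x (soundˡ F∈ .above) v∉I)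
             (λ x∈ → x∈p∧x≢y⇒x∈p-y (Lk.sound F∈ .below (p-x⊆p F v x∈)) (x∈p-y⇒x≢y F x∈))
             (Δ-⊆ (p-x⊆p F v) (Lk.sound F∈ .face))
           = v , v∈link F∈ , v∉deletion E∈ᵈ , K , ∈-++⁺ˡ K∈ , F-v⊆K

  module _ (shed : ∀ {I V} → I ⊆ V → Δ I → ¬ Δ V →
                   ∃ λ v → v ∈ V × v ∉ I × Shedding I V v) where

    -- Induction on the number of vertices of `V ─ I`: the deletion takes `v` out of `V`, the link
    -- puts it into `I`.
    shelling : ∀ k {I V} → ∣ V ─ I ∣ < k → I ⊆ V → Shelling I V
    shelling (suc k) {I} {V} (s≤s size) I⊆V with Δ? I
    ... | no ¬ΔI = void ¬ΔI
    ... | yes ΔI with Δ? V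
    ...   | yes ΔV = simplex I⊆V ΔV
    ...   | no ¬ΔV with v , v∈V , v∉I , shedding ← shed I⊆V ΔI ¬ΔV =
      glue v∈V v∉I shedding
        (shelling k (ℕₚ.<-≤-trans (p⊂q⇒∣p∣<∣q∣ (shrinkᵈ , v , v∈V─I , v∉ᵈ)) size)
          (p⊆q-x I⊆V v∉I))
        (shelling k (ℕₚ.<-≤-trans (p⊂q⇒∣p∣<∣q∣ (shrinkˡ , v , v∈V─I , v∉ˡ)) size)
          (p∪x⊆q I⊆V v∈V))
      where
      v∈V─I : v ∈ V ─ I
      v∈V─I = x∈p∧x∉q⇒x∈p─q v∈V v∉I
      shrinkᵈ : (V - v) ─ I ⊆ V ─ I
      shrinkᵈ x∈ = x∈p∧x∉q⇒x∈p─q (p-x⊆p V v (p─q⊆p (V - v) I x∈)) (x∈p─q⇒x∉q (V - v) I x∈)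
      v∉ᵈ : v ∉ (V - v) ─ I
      v∉ᵈ v∈ = x∈p-y⇒x≢y V (p─q⊆p (V - v) I v∈) refl
      shrinkˡ : V ─ (I ∪ ⁅ v ⁆) ⊆ V ─ I
      shrinkˡ x∈ = x∈p∧x∉q⇒x∈p─q (p─q⊆p V (I ∪ ⁅ v ⁆) x∈)
        λ x∈I → x∈p─q⇒x∉q V (I ∪ ⁅ v ⁆) x∈ (p⊆p∪q ⁅ v ⁆ x∈I)
      v∉ˡ : v ∉ V ─ (I ∪ ⁅ v ⁆)
      v∉ˡ v∈ = x∈p─q⇒x∉q V (I ∪ ⁅ v ⁆) v∈ (x∈p∪x I v)

    shellable : Shellable Δ
    shellable = S.facets , S.unique , complete , facet , pure
      where
      module S = Shelling (shelling _ {∅} {full} (ℕₚ.n<1+n _) (⊆-min full))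

      complete : ∀ F → IsFacet Δ F → F LM.∈ S.facets
      complete F (ΔF , max) with K , K∈ , F⊆K ← S.cover (⊆-min F) (⊆-max F) ΔF =
        subst (LM._∈ S.facets) (max K (S.sound K∈ .face) F⊆K) K∈

      facet : ∀ F → F LM.∈ S.facets → IsFacet Δ F
      facet F F∈ = S.sound F∈ .face ,
        λ τ Δτ F⊆τ → ⊆-antisym (S.sound F∈ .maximal F⊆τ (⊆-max τ) Δτ) F⊆τ

      -- A facet `σ` of the intersection lies in `F ∩ E` for an earlier `E`, hence in some `F - x`
      -- that also belongs to the intersection; maximality makes the two equal.
      pure : ∀ pre F post → S.facets ≡ pre ++ F ∷ post → pre ≢ [] →
             PureCard (MeetComplex F pre) (∣ F ∣ ∸ 1)
      pure pre F post eq _ σ ((σ⊆F , σ⊆pre) , max)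
        with E , E∈ , σ⊆E ← LM.find σ⊆pre
        with x , x∈F , x∉E , K , K∈ , F-x⊆K ← S.shells pre eq E∈
        = trans (cong ∣_∣ (≡-sym (max (F - x) (p-x⊆p F x , LM.lose K∈ F-x⊆K)
            (p⊆q-x σ⊆F λ x∈σ → x∉E (σ⊆E x∈σ)))))
          (∣p-x∣≡∣p∣∸1 F x∈F)

-- Walks, components and cycles

module Walks (G : Graph) where

  private
    variable
      S S′ : Subset (n G)
      u v w y z : Fin (n G)

  edge-sym : Edge G u v → Edge G v u
  edge-sym {u} {v} = subst T (Graph.sym G u v)

  source∈ : Walk G S u v → u ∈ S
  source∈ (here u∈)     = u∈
  source∈ (step u∈ _ _) = u∈

  target∈ : Walk G S u v → v ∈ S
  target∈ (here v∈)    = v∈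
  target∈ (step _ _ p) = target∈ p

  walk-⊆ : S ⊆ S′ → Walk G S u v → Walk G S′ u v
  walk-⊆ S⊆ (here v∈)     = here (S⊆ v∈)
  walk-⊆ S⊆ (step u∈ e p) = step (S⊆ u∈) e (walk-⊆ S⊆ p)

  infixr 5 _⊕_
  _⊕_ : Walk G S u v → Walk G S v w → Walk G S u w
  here _      ⊕ q = q
  step u∈ e p ⊕ q = step u∈ e (p ⊕ q)

  snoc : Walk G S u v → Edge G v w → w ∈ S → Walk G S u w
  snoc p e w∈ = p ⊕ step (target∈ p) e (here w∈)

  reverse : Walk G S u v → Walk G S v u
  reverse (here v∈)     = here v∈
  reverse (step u∈ e p) = snoc (reverse p) (edge-sym e) u∈

  invariant : (P : Fin (n G) → Set) → (∀ {u w} → u ∈ S → w ∈ S → Edge G u w → P u → P w) →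
    Walk G S u v → P u → P v
  invariant P pres (here _)      Pu = Pu
  invariant P pres (step u∈ e p) Pu = invariant P pres p (pres u∈ (source∈ p) e Pu)

  exit : ∀ C → Walk G S u v → u ∈ C → v ∉ C →
    ∃ λ x → ∃ λ w → x ∈ C × w ∈ S × w ∉ C × Edge G x w
  exit C (here _) u∈C v∉C = contradiction u∈C v∉C
  exit C (step {w = w} _ e p) u∈C v∉C with w ∈? C
  ... | yes w∈C = exit C p w∈C v∉C
  ... | no  w∉C = _ , w , u∈C , source∈ p , w∉C , e

  -- The part of a walk after its last visit to x avoids x.
  avoid : ∀ x → Walk G S u v →
    Walk G (S - x) u v ⊎ x ≡ v ⊎ ∃ λ w → Edge G x w × Walk G (S - x) w v
  avoid {v = v} x (here v∈) with x ≟ v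
  ... | yes x≡v = inj₂ (inj₁ x≡v)
  ... | no  x≢v = inj₁ (here (x∈p∧x≢y⇒x∈p-y v∈ (x≢v ∘ ≡-sym)))
  avoid {u = u} x (step u∈ e p) with avoid x p
  ... | inj₂ later = inj₂ later
  ... | inj₁ q with x ≟ u
  ...   | yes refl = inj₂ (inj₂ (_ , e , q))
  ...   | no  x≢u  = inj₁ (step (x∈p∧x≢y⇒x∈p-y u∈ (x≢u ∘ ≡-sym)) e q)

  -- By `avoid`, a walk from `u` to another vertex may be assumed never to return to `u`, so the
  -- search continues from a neighbour in the smaller set `S - u`.
  walk? : ∀ S u v → Dec (Walk G S u v)
  walk? S = search ∣ S ∣ S ℕₚ.≤-refl
    where
    search : ∀ k S → ∣ S ∣ ≤ k → ∀ u v → Dec (Walk G S u v)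
    search k S size u v with u ∈? S
    ... | no u∉S = no (u∉S ∘ source∈)
    ... | yes u∈S with u ≟ v
    ...   | yes refl = yes (here u∈S)
    search zero S size u v | yes u∈S | no _
      with () ← ℕₚ.<-≤-trans (x∈p⇒∣p-x∣<∣p∣ u∈S) size
    search (suc k) S size u v | yes u∈S | no u≢v = map′
      (λ (w , e , p) → step u∈S e (walk-⊆ (p-x⊆p S u) p))
      (λ p → [ (λ q → contradiction refl (x∈p-y⇒x≢y S (source∈ q)))
             , [ (λ u≡v → contradiction u≡v u≢v) , (λ found → found) ]′ ]′ (avoid u p))
      (any? λ w → T? (adj G u w) ×-dec
        search k (S - u) (ℕₚ.≤-pred (ℕₚ.<-≤-trans (x∈p⇒∣p-x∣<∣p∣ u∈S) size)) w v)

  connectedIn? : Decidable (ConnectedIn G)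
  connectedIn? S = all? λ u → all? λ v → u ∈? S →-dec v ∈? S →-dec walk? S u v

  -- Opaque, so that S and v can be recovered from component S v by unification.
  abstract
    component : Subset (n G) → Fin (n G) → Subset (n G)
    component S v = ⟪ walk? S v ⟫

    ∈-component⁺ : Walk G S v u → u ∈ component S v
    ∈-component⁺ {S} {v} = ∈⟪⟫⁺ (walk? S v)

    ∈-component⁻ : u ∈ component S v → Walk G S v u
    ∈-component⁻ {S = S} {v} = ∈⟪⟫⁻ (walk? S v)

  component⊆ : component S v ⊆ S
  component⊆ u∈ = target∈ (∈-component⁻ u∈)

  component-closed : z ∈ component S v → y ∈ S → Edge G z y → y ∈ component S v
  component-closed x∈ y∈S e = ∈-component⁺ (snoc (∈-component⁻ x∈) e y∈S)

  component-walk : Walk G S v u → Walk G (component S v) v u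
  component-walk {S = S} {v} p = proj₂ (invariant (λ y → Walk G S v y × Walk G (component S v) v y)
    (λ _ w∈S e (q , q′) → snoc q e w∈S , snoc q′ e (∈-component⁺ (snoc q e w∈S)))
    p (here v∈S , here (∈-component⁺ (here v∈S))))
    where v∈S = source∈ p

  component-connected : ConnectedIn G (component S v)
  component-connected u w u∈ w∈ =
    reverse (component-walk (∈-component⁻ u∈)) ⊕ component-walk (∈-component⁻ w∈)

  -- Simple paths, indexed by their exact vertex sets, so that the vertices of a cycle closed up
  -- from one are known.
  data Path : Subset (n G) → Fin (n G) → Fin (n G) → Set where
    end  : Path ⁅ v ⁆ v v
    cons : u ∉ S → Edge G u w → Path S w v → Path (S ∪ ⁅ u ⁆) u v

  path-source∈ : Path S u v → u ∈ S
  path-source∈ end                  = x∈⁅x⁆ _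
  path-source∈ (cons {S = S} _ _ _) = x∈p∪x S _

  suffix : Path S u v → z ∈ S → ∃ λ S′ → S′ ⊆ S × Path S′ z v
  suffix {v = v} end x∈ with refl ← x∈⁅y⁆⇒x≡y v x∈ = _ , (λ y∈ → y∈) , end
  suffix p@(cons {u = u} {S = S} _ _ q) x∈ with x∈p∪q⁻ S ⁅ u ⁆ x∈
  ... | inj₂ x∈u with refl ← x∈⁅y⁆⇒x≡y u x∈u = _ , (λ y∈ → y∈) , p
  ... | inj₁ x∈S with S′ , S′⊆S , q′ ← suffix q x∈S = S′ , (λ y∈ → p⊆p∪q ⁅ u ⁆ (S′⊆S y∈)) , q′

  toPath : Walk G S u v → ∃ λ S′ → S′ ⊆ S × Path S′ u v
  toPath (here v∈) = _ , (λ x∈ → subst (_∈ _) (≡-sym (x∈⁅y⁆⇒x≡y _ x∈)) v∈) , end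
  toPath (step {u = u} u∈ e p) with S′ , S′⊆S , q ← toPath p with u ∈? S′
  ... | no  u∉S′ = S′ ∪ ⁅ u ⁆ , p∪x⊆q S′⊆S u∈ , cons u∉S′ e q
  -- Loop erasure: the path already visits `u`, so restart at that visit.
  ... | yes u∈S′ with S″ , S″⊆S′ , q′ ← suffix q u∈S′ = S″ , (λ x∈ → S′⊆S (S″⊆S′ x∈)) , q′

  path-walk : Path S u v → y ∈ S → Walk G S y v
  path-walk {v = v} end x∈ with refl ← x∈⁅y⁆⇒x≡y v x∈ = here x∈
  path-walk (cons {u = u} {S = S} _ e q) x∈ with x∈p∪q⁻ S ⁅ u ⁆ x∈
  ... | inj₁ x∈S = walk-⊆ (p⊆p∪q ⁅ u ⁆) (path-walk q x∈S)
  ... | inj₂ x∈u with refl ← x∈⁅y⁆⇒x≡y u x∈u =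
    step x∈ e (walk-⊆ (p⊆p∪q ⁅ u ⁆) (path-walk q (path-source∈ q)))

  -- Removing `z` leaves at most two pieces of the path, and each retains one of the two ends.
  path-delete : Path S u v → y ∈ S - z → Walk G (S - z) y u ⊎ Walk G (S - z) y v
  path-delete {v = v} {z = x} end y∈ with refl ← x∈⁅y⁆⇒x≡y v (p-x⊆p ⁅ v ⁆ x y∈) = inj₁ (here y∈)
  path-delete {y = y} {z = x} (cons {u = u} {S = S} u∉S e q) y∈
    with x∈p∪q⁻ S ⁅ u ⁆ (p-x⊆p (S ∪ ⁅ u ⁆) x y∈)
  ... | inj₂ y∈u with refl ← x∈⁅y⁆⇒x≡y u y∈u = inj₁ (here y∈)
  ... | inj₁ y∈S with x ≟ u
  ...   | yes refl = inj₂ (walk-⊆ (p⊆q-x (p⊆p∪q ⁅ u ⁆) u∉S) (path-walk q y∈S))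
  ...   | no x≢u with path-delete q (x∈p∧x≢y⇒x∈p-y y∈S (x∈p-y⇒x≢y (S ∪ ⁅ u ⁆) y∈))
  ...     | inj₁ r = inj₁ (snoc (walk-⊆ (p-x⊆q-x (p⊆p∪q ⁅ u ⁆)) r) (edge-sym e)
                       (x∈p∧x≢y⇒x∈p-y (x∈p∪x S u) (x≢u ∘ ≡-sym)))
  ...     | inj₂ r = inj₂ (walk-⊆ (p-x⊆q-x (p⊆p∪q ⁅ u ⁆)) r)

  connected-through : ∀ c → (∀ {y} → y ∈ S → Walk G S y c) → ConnectedIn G S
  connected-through c to u v u∈ v∈ = to u∈ ⊕ reverse (to v∈)

  -- The closing vertex turns the path into a cycle, or into an edge if `u` is `v`. Deleting it
  -- leaves the path; deleting any other vertex leaves pieces that still reach it from an end of the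
  -- path.
  cycle-nonseparable : Path S u v → z ∉ S → Edge G u z → Edge G z v →
    Nonseparable G (S ∪ ⁅ z ⁆)
  cycle-nonseparable {S = S} {u} {v} {x} p x∉S ux xv = connected , deleted
    where
    C = S ∪ ⁅ x ⁆
    connected : ConnectedIn G C
    connected = connected-through x to
      where
      to : ∀ {y} → y ∈ C → Walk G C y x
      to y∈ with x∈p∪q⁻ S ⁅ x ⁆ y∈
      ... | inj₁ y∈S = snoc (walk-⊆ (p⊆p∪q ⁅ x ⁆) (path-walk p y∈S)) (edge-sym xv) (x∈p∪x S x)
      ... | inj₂ y∈x with refl ← x∈⁅y⁆⇒x≡y x y∈x = here y∈
    deleted : ∀ z → z ∈ C → ConnectedIn G (C - z)
    deleted z z∈ with z ≟ x
    ... | yes refl = λ y y′ y∈ y′∈ → to y∈ ⊕ reverse (to y′∈)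
      where
      to : ∀ {y} → y ∈ C - x → Walk G (C - x) y v
      to y∈ with x∈p∪q⁻ S ⁅ x ⁆ (p-x⊆p C x y∈)
      ... | inj₁ y∈S = walk-⊆ (p⊆q-x (p⊆p∪q ⁅ x ⁆) x∉S) (path-walk p y∈S)
      ... | inj₂ y∈x = contradiction (x∈⁅y⁆⇒x≡y x y∈x) (x∈p-y⇒x≢y C y∈)
    ... | no z≢x = connected-through x to
      where
      x∈C-z : x ∈ C - z
      x∈C-z = x∈p∧x≢y⇒x∈p-y (x∈p∪x S x) (z≢x ∘ ≡-sym)
      S-z⊆ : S - z ⊆ C - z
      S-z⊆ = p-x⊆q-x (p⊆p∪q ⁅ x ⁆)
      to : ∀ {y} → y ∈ C - z → Walk G (C - z) y x
      to y∈ with x∈p∪q⁻ S ⁅ x ⁆ (p-x⊆p C z y∈)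
      ... | inj₂ y∈x with refl ← x∈⁅y⁆⇒x≡y x y∈x = here y∈
      ... | inj₁ y∈S with path-delete p (x∈p∧x≢y⇒x∈p-y y∈S (x∈p-y⇒x≢y C y∈))
      ...   | inj₁ q = snoc (walk-⊆ S-z⊆ q) ux x∈C-z
      ...   | inj₂ q = snoc (walk-⊆ S-z⊆ q) (edge-sym xv) x∈C-z

  -- Nonseparable sets in block graphs.

  BlocksAreCliques : Set
  BlocksAreCliques = ∀ W → IsComponent G W → ∀ S → BlockIn G W S → Clique G S

  component-isComponent : ∀ v → IsComponent G (component full v)
  component-isComponent v =
    (v , ∈-component⁺ (here ∈⊤)) , component-connected , λ _ _ u∈ → component-closed u∈ ∈⊤

  nonseparable⇒clique : BlocksAreCliques → ∀ S → Nonseparable G S → Clique G S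
  nonseparable⇒clique blocks S S-ns u v u∈S v∈S u≢v =
    decidable-stable (T? (adj G u v)) λ ¬uv →
      -- `∣ S ∣ + k` stays above `n G` as `S` grows, so running out of `k` would give a set with
      -- more than `n G` vertices.
      enlarge ¬uv (suc (n G)) S (ℕₚ.m≤n+m (suc (n G)) ∣ S ∣) S-ns u∈S v∈S
    where
    W = component full u
    -- If u and v were not adjacent, S could be enlarged forever: a maximal S is
    -- a block, hence a clique.
    enlarge : ¬ Edge G u v → ∀ k S → n G < ∣ S ∣ + k → Nonseparable G S → u ∈ S → v ∈ S → ⊥
    enlarge ¬uv zero S size _ _ _ =
      ℕₚ.<⇒≱ size (ℕₚ.≤-trans (ℕₚ.≤-reflexive (ℕₚ.+-identityʳ ∣ S ∣)) (∣p∣≤n S))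
    enlarge ¬uv (suc k) S size S-ns u∈S v∈S =
      ¬uv (blocks W (component-isComponent u) S
        ((λ x∈ → ∈-component⁺ (walk-⊆ (⊆-max S) (proj₁ S-ns u _ u∈S x∈))) , S-ns , maximal)
        u v u∈S v∈S u≢v)
      where
      maximal : ∀ U → U ⊆ W → S ⊆ U → Nonseparable G U → U ≡ S
      maximal U _ S⊆U U-ns with U ⊆? S
      ... | yes U⊆S = ⊆-antisym U⊆S S⊆U
      ... | no  U⊈S = ⊥-elim (enlarge ¬uv k U
        (ℕₚ.<-≤-trans size (ℕₚ.≤-trans (ℕₚ.≤-reflexive (ℕₚ.+-suc ∣ S ∣ k))
          (ℕₚ.+-monoˡ-≤ k (p⊂q⇒∣p∣<∣q∣ (S⊆U , ⊈⇒∃ U S U⊈S)))))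
        U-ns (S⊆U u∈S) (S⊆U v∈S))

  -- The walk shortens to a path that `z` closes up to a cycle, and the vertices of a cycle form a
  -- clique in a block graph.
  neighbours-adjacent : BlocksAreCliques → z ∉ S → Walk G S u v → Edge G u z → Edge G z v →
    u ≢ v → Edge G u v
  neighbours-adjacent {z = x} {u = u} {v} blocks x∉S p ux xv u≢v with S′ , S′⊆S , q ← toPath p =
    nonseparable⇒clique blocks (S′ ∪ ⁅ x ⁆)
      (cycle-nonseparable q (x∉S ∘ S′⊆S) ux xv) u v
      (p⊆p∪q ⁅ x ⁆ (path-source∈ q))
      (p⊆p∪q ⁅ x ⁆ (target∈ (path-walk q (path-source∈ q)))) u≢v

-- Higher independence complexes

module HigherIndependence (G : Graph) (r : ℕ) where

  open Walks G

  -- Restates `r`-independence by cardinalities of connected sets, so that its failure yields one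
  -- with more than `r` vertices.
  Small : Subset (n G) → Set
  Small S = ∀ C → C ⊆ S → ConnectedIn G C → ∣ C ∣ ≤ r

  small-or-large : ∀ S → Small S ⊎ ∃ λ C → C ⊆ S × ConnectedIn G C × r < ∣ C ∣
  small-or-large S with anySubset? (λ C → C ⊆? S ×-dec connectedIn? C ×-dec r <? ∣ C ∣)
  ... | yes large = inj₂ large
  ... | no  ¬large = inj₁ λ C C⊆S conn → ℕₚ.≮⇒≥ λ r<C → ¬large (C , C⊆S , conn , r<C)

  small? : Decidable Small
  small? S with small-or-large S
  ... | inj₁ small = yes small
  ... | inj₂ (C , C⊆S , conn , r<C) = no λ small → ℕₚ.<⇒≱ r<C (small C C⊆S conn)

  independent⇒small : ∀ {S} → Ind G r S → Small S
  independent⇒small {S} ind C C⊆S conn with nonempty? C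
  ... | no empty rewrite Empty-unique empty = ℕₚ.≤-trans (ℕₚ.≤-reflexive (∣⊥∣≡0 (n G))) z≤n
  ... | yes (v , v∈C) = ℕₚ.≤-trans
    (covering⇒∣p∣≤length C xs λ u∈C → ∈-filter⁺ (_∈? C) (∈-allFin _) u∈C)
    (ind v (C⊆S v∈C) xs (Uniqueₚ.filter⁺ (_∈? C) (Uniqueₚ.allFin⁺ (n G)))
      (All.map (λ u∈C → walk-⊆ C⊆S (conn v _ v∈C u∈C)) (Allₚ.all-filter (_∈? C) (allFin (n G)))))
    where xs = filter (_∈? C) (allFin (n G))

  small⇒independent : ∀ {S} → Small S → Ind G r S
  small⇒independent {S} small v v∈S xs xs! walks = ℕₚ.≤-trans
    (unique⇒length≤ (component S v) xs! (All.map ∈-component⁺ walks))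
    (small (component S v) component⊆ component-connected)

  independent-⊆ : ∀ {S S′} → S ⊆ S′ → Ind G r S′ → Ind G r S
  independent-⊆ S⊆S′ ind v v∈S xs xs! walks =
    ind v (S⊆S′ v∈S) xs xs! (All.map (walk-⊆ S⊆S′) walks)

  -- Connected sets missing `w` already lie in `σ`, so the bound is at stake only for those through
  -- the new vertex.
  small-swap : ∀ {σ v w} → Small σ →
    (∀ C → C ⊆ (σ - v) ∪ ⁅ w ⁆ → ConnectedIn G C → w ∈ C → ∣ C ∣ ≤ r) →
    Small ((σ - v) ∪ ⁅ w ⁆)
  small-swap {σ} {v} {w} small small-at-w C C⊆ conn with w ∈? C
  ... | yes w∈C = small-at-w C C⊆ conn w∈C
  ... | no  w∉C = small C C⊆σ conn
    where
    C⊆σ : C ⊆ σ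
    C⊆σ y∈C with x∈p∪q⁻ (σ - v) ⁅ w ⁆ (C⊆ y∈C)
    ... | inj₁ y∈ = p-x⊆p σ v y∈
    ... | inj₂ y∈w = contradiction (subst (_∈ C) (x∈⁅y⁆⇒x≡y w y∈w) y∈C) w∉C

  independent? : Decidable (Ind G r)
  independent? S = map′ small⇒independent independent⇒small (small? S)

  -- Separation from a root, and the two exchanges it allows.

  module Dominators (blocks : BlocksAreCliques) {V X : Subset (n G)} (ρ : Fin (n G))
    (X⊆V : X ⊆ V) (X-connected : ConnectedIn G X)
    (X-closed : ∀ {u y} → u ∈ X → y ∈ V → Edge G u y → y ∈ X) (ρ∈X : ρ ∈ X) where

    abstract
      -- The vertices dominated by `v` in the sense of rooted flow graphs; for the root itself this
      -- is all of `X`.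
      D : Fin (n G) → Subset (n G)
      D v = ⟪ (λ u → u ∈? X ×-dec ¬? (walk? (X - v) ρ u)) ⟫

      ∈D⁺ : ∀ {u v} → u ∈ X → ¬ Walk G (X - v) ρ u → u ∈ D v
      ∈D⁺ {v = v} u∈X ¬walk = ∈⟪⟫⁺ (λ u → u ∈? X ×-dec ¬? (walk? (X - v) ρ u)) (u∈X , ¬walk)

      ∈D⁻ : ∀ {u v} → u ∈ D v → u ∈ X × ¬ Walk G (X - v) ρ u
      ∈D⁻ {v = v} = ∈⟪⟫⁻ (λ u → u ∈? X ×-dec ¬? (walk? (X - v) ρ u))

    D⊆X : ∀ {v} → D v ⊆ X
    D⊆X u∈ = proj₁ (∈D⁻ u∈)

    ∉D⇒walk : ∀ {u v} → u ∈ X → u ∉ D v → Walk G (X - v) ρ u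
    ∉D⇒walk {u} {v} u∈X u∉D = decidable-stable (walk? (X - v) ρ u) (u∉D ∘ ∈D⁺ u∈X)

    D-refl : ∀ {v} → v ∈ X → v ∈ D v
    D-refl v∈X = ∈D⁺ v∈X λ p → x∈p-y⇒x≢y X (target∈ p) refl

    -- Otherwise a walk from the root to `y` that avoids `v` could be prolonged to `u`.
    D-closed : ∀ {u v y} → u ∈ D v → u ≢ v → y ∈ V → Edge G u y → y ∈ D v
    D-closed u∈D u≢v y∈V uy = ∈D⁺ (X-closed (D⊆X u∈D) y∈V uy)
      λ p → proj₂ (∈D⁻ u∈D) (snoc p (edge-sym uy) (x∈p∧x≢y⇒x∈p-y (D⊆X u∈D) u≢v))

    -- A walk in `X` from `u` to `v` stays in `D v` until it first meets `v`, by `D-closed`.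
    D-walk : ∀ {u v} → v ∈ X → u ∈ D v → Walk G (D v) v u
    D-walk {v = v} v∈X u∈D = reverse (go (X-connected _ _ (D⊆X u∈D) v∈X) u∈D)
      where
      go : ∀ {u} → Walk G X u v → u ∈ D v → Walk G (D v) u v
      go (here _) u∈D = here u∈D
      go {u} (step _ e p) u∈D with u ≟ v
      ... | yes refl = here u∈D
      ... | no  u≢v  = step u∈D e (go p (D-closed u∈D u≢v (X⊆V (source∈ p)) e))

    D-connected : ∀ {v} → v ∈ X → ConnectedIn G (D v)
    D-connected v∈X u w u∈ w∈ = reverse (D-walk v∈X u∈) ⊕ D-walk v∈X w∈

    -- A walk from the root that avoids `w` never meets `v`, since that would reach `v` without `w`.
    -- So whatever it reaches is reached without `v` too.
    D-trans : ∀ {v w} → v ∈ D w → D v ⊆ D w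
    D-trans {v} {w} v∈Dw {u} u∈Dv = ∈D⁺ (D⊆X u∈Dv) λ p → proj₂ (∈D⁻ u∈Dv)
      (proj₂ (invariant Both preserved p
        (here (source∈ p) , here (x∈p∧x≢y⇒x∈p-y ρ∈X (≢v (here (source∈ p)))))))
      where
      Both : Fin (n G) → Set
      Both y = Walk G (X - w) ρ y × Walk G (X - v) ρ y
      ≢v : ∀ {y} → Walk G (X - w) ρ y → y ≢ v
      ≢v p refl = proj₂ (∈D⁻ v∈Dw) p
      preserved : ∀ {y y′} → y ∈ X - w → y′ ∈ X - w → Edge G y y′ → Both y → Both y′
      preserved _ y′∈ e (p , q) =
        snoc p e y′∈ , snoc q e (x∈p∧x≢y⇒x∈p-y (p-x⊆p X w y′∈) (≢v (snoc p e y′∈)))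

    -- Along a walk from the root to `v`, whichever of `v` and `w` comes first is reached without
    -- the other. `Both` persists as long as neither has been met.
    D-antisym : ∀ {v w} → v ≢ w → v ∈ D w → w ∉ D v
    D-antisym {v} {w} v≢w v∈Dw w∈Dv = v-unreachable
      (proj₁ (invariant Both preserved (X-connected ρ v ρ∈X (D⊆X v∈Dw)) root))
      where
      Both : Fin (n G) → Set
      Both y = Walk G (X - w) ρ y × Walk G (X - v) ρ y
      v-unreachable : ¬ Walk G (X - w) ρ v
      v-unreachable = proj₂ (∈D⁻ v∈Dw)
      w-unreachable : ¬ Walk G (X - v) ρ w
      w-unreachable = proj₂ (∈D⁻ w∈Dv)
      root : Both ρ
      root = here (x∈p∧x≢y⇒x∈p-y ρ∈X λ { refl →
               w-unreachable (here (x∈p∧x≢y⇒x∈p-y ρ∈X (v≢w ∘ ≡-sym))) })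
           , here (x∈p∧x≢y⇒x∈p-y ρ∈X λ { refl →
               v-unreachable (here (x∈p∧x≢y⇒x∈p-y ρ∈X v≢w)) })
      preserved : ∀ {y y′} → y ∈ X → y′ ∈ X → Edge G y y′ → Both y → Both y′
      preserved {y′ = y′} _ y′∈X e (p , q) with y′ ≟ v | y′ ≟ w
      ... | yes refl | _ = contradiction (snoc p e (x∈p∧x≢y⇒x∈p-y y′∈X v≢w)) v-unreachable
      ... | no _ | yes refl =
        contradiction (snoc q e (x∈p∧x≢y⇒x∈p-y y′∈X (v≢w ∘ ≡-sym))) w-unreachable
      ... | no y′≢v | no y′≢w =
        snoc p e (x∈p∧x≢y⇒x∈p-y y′∈X y′≢w) , snoc q e (x∈p∧x≢y⇒x∈p-y y′∈X y′≢v)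

    D-shrinks : ∀ {v w} → v ∈ D w → w ∈ X → w ∉ D v → ∣ D v ∣ < ∣ D w ∣
    D-shrinks v∈Dw w∈X w∉Dv = p⊂q⇒∣p∣<∣q∣ (D-trans v∈Dw , _ , D-refl w∈X , w∉Dv)

    -- y and z are joined through the root by a walk avoiding w.
    outer-neighbours-adjacent : ∀ {w y z} → y ∈ X → y ∉ D w → z ∈ X → z ∉ D w →
      Edge G y w → Edge G w z → y ≢ z → Edge G y z
    outer-neighbours-adjacent {w} y∈X y∉D z∈X z∉D yw wz = neighbours-adjacent blocks
      (λ w∈ → x∈p-y⇒x≢y X w∈ refl)
      (reverse (∉D⇒walk y∈X y∉D) ⊕ ∉D⇒walk z∈X z∉D) yw wz

    -- With `v` gone, a connected set through `w` cannot leave `D v`, by `D-closed`.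
    swap-below : ∀ {σ v w} → σ ⊆ V → v ∈ σ → Small σ → Small (D v - v) → w ∈ D v → w ∉ σ →
      Small ((σ - v) ∪ ⁅ w ⁆)
    swap-below {σ} {v} {w} σ⊆V v∈σ small small-below w∈D w∉σ = small-swap small
      λ C C⊆ conn w∈C → small-below C (λ u∈C → proj₂ (invariant (λ u → u ∈ C × u ∈ D v - v)
        (λ _ y∈C e (_ , u∈) → y∈C , x∈p∧x≢y⇒x∈p-y
          (D-closed (p-x⊆p (D v) v u∈) (x∈p-y⇒x≢y (D v) u∈) (⊆V C⊆ y∈C) e) (≢v C⊆ y∈C))
        (conn w _ w∈C u∈C) (w∈C , x∈p∧x≢y⇒x∈p-y w∈D (≢v C⊆ w∈C)))) conn
      where
      ≢v : ∀ {C} → C ⊆ (σ - v) ∪ ⁅ w ⁆ → ∀ {y} → y ∈ C → y ≢ v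
      ≢v C⊆ y∈C refl with x∈p∪q⁻ (σ - v) ⁅ w ⁆ (C⊆ y∈C)
      ... | inj₁ v∈ = x∈p-y⇒x≢y σ v∈ refl
      ... | inj₂ v∈w with refl ← x∈⁅y⁆⇒x≡y w v∈w = w∉σ v∈σ
      ⊆V : ∀ {C} → C ⊆ (σ - v) ∪ ⁅ w ⁆ → C ⊆ V
      ⊆V C⊆ y∈C = p∪x⊆q (λ y∈ → σ⊆V (p-x⊆p σ v y∈)) (X⊆V (D⊆X w∈D)) (C⊆ y∈C)

    -- Removing v detaches all of D v from its component K, and adding w
    -- attaches to the rest of K nothing beyond D w.
    swap-across : ∀ {σ v w x} → σ ⊆ V → v ∈ σ → v ∈ X → Small σ → D v ⊆ σ →
      w ∈ V → w ∉ σ → x ∈ component σ v → Edge G x w → ∣ D w ∣ ≤ ∣ D v ∣ →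
      Small ((σ - v) ∪ ⁅ w ⁆)
    swap-across {σ} {v} {w} {x} σ⊆V v∈σ v∈X small Dv⊆σ w∈V w∉σ x∈K xw Dw≤Dv =
      small-swap small bound
      where
      K = component σ v
      K⊆X : K ⊆ X
      K⊆X y∈K = invariant (_∈ X) (λ _ y∈σ e u∈X → X-closed u∈X (σ⊆V y∈σ) e) (∈-component⁻ y∈K) v∈X
      Dv⊆K : D v ⊆ K
      Dv⊆K u∈ = ∈-component⁺ (walk-⊆ Dv⊆σ (D-walk v∈X u∈))
      w∉K : w ∉ K
      w∉K w∈K = w∉σ (component⊆ w∈K)
      w∉Dv : w ∉ D v
      w∉Dv w∈ = w∉σ (Dv⊆σ w∈)
      w∈X : w ∈ X
      w∈X = X-closed (K⊆X x∈K) w∈V xw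
      -- The component `K` avoids `w`, so `x ∈ D w` would carry over to `v`, and `D v` would be
      -- strictly smaller than `D w`.
      x∉Dw : x ∉ D w
      x∉Dw x∈Dw = ℕₚ.<⇒≱ (D-shrinks v∈Dw w∈X w∉Dv) Dw≤Dv
        where
        v∈Dw : v ∈ D w
        v∈Dw = invariant (_∈ D w)
          (λ u∈K y∈K e u∈Dw → D-closed u∈Dw (λ { refl → w∉K u∈K }) (X⊆V (K⊆X y∈K)) e)
          (component-connected _ _ x∈K (∈-component⁺ (here v∈σ))) x∈Dw
      bound : ∀ C → C ⊆ (σ - v) ∪ ⁅ w ⁆ → ConnectedIn G C → w ∈ C → ∣ C ∣ ≤ r
      bound C C⊆ conn w∈C = begin
        ∣ C ∣                      ≤⟨ p⊆q⇒∣p∣≤∣q∣ C⊆Dw∪K∖Dv ⟩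
        ∣ D w ∪ (K ∩ ∁ (D v)) ∣    ≤⟨ ∣p∪q∣≤∣p∣+∣q∣ (D w) (K ∩ ∁ (D v)) ⟩
        ∣ D w ∣ + ∣ K ∩ ∁ (D v) ∣  ≤⟨ ℕₚ.+-monoˡ-≤ _ Dw≤Dv ⟩
        ∣ D v ∣ + ∣ K ∩ ∁ (D v) ∣  ≤⟨ ∣q∣+∣p∩∁q∣≤∣p∣ Dv⊆K ⟩
        ∣ K ∣                      ≤⟨ small K component⊆ component-connected ⟩
        r                          ∎
        where
        open ℕₚ.≤-Reasoning
        ∈σ-v : ∀ {y} → y ∈ C → y ≢ w → y ∈ σ × y ≢ v
        ∈σ-v y∈C y≢w with x∈p∪q⁻ (σ - v) ⁅ w ⁆ (C⊆ y∈C)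
        ... | inj₁ y∈ = p-x⊆p σ v y∈ , x∈p-y⇒x≢y σ y∈
        ... | inj₂ y∈w = contradiction (x∈⁅y⁆⇒x≡y w y∈w) y≢w

        Location : Fin (n G) → Set
        Location u = u ∈ D w ⊎ (u ∈ K × u ∉ D v)

        preserved : ∀ {u y} → u ∈ C → y ∈ C → Edge G u y → Location u → Location y
        preserved {u} {y} u∈C y∈C e loc with y ∈? D w
        ... | yes y∈Dw = inj₁ y∈Dw
        ... | no y∉Dw = inj₂ (y∈K loc , y∉Dv loc)
          where
          y≢w : y ≢ w
          y≢w refl = y∉Dw (D-refl w∈X)
          y∈σ : y ∈ σ
          y∈σ = proj₁ (∈σ-v y∈C y≢w)
          y≢v : y ≢ v
          y≢v = proj₂ (∈σ-v y∈C y≢w)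
          u≡w : u ∈ D w → u ≡ w
          u≡w u∈Dw = decidable-stable (u ≟ w) λ u≢w → y∉Dw (D-closed u∈Dw u≢w (σ⊆V y∈σ) e)
          -- `D w` can be left only at `w`. Then `x` and `y` are both neighbours of `w` outside
          -- `D w`, hence equal or adjacent, and `y` joins `K` through `x`.
          y∈K : Location u → y ∈ K
          y∈K (inj₂ (u∈K , _)) = component-closed u∈K y∈σ e
          y∈K (inj₁ u∈Dw) with refl ← u≡w u∈Dw with x ≟ y
          ... | yes refl = x∈K
          ... | no  x≢y  = component-closed x∈K y∈σ
            (outer-neighbours-adjacent (K⊆X x∈K) x∉Dw (X-closed w∈X (σ⊆V y∈σ) e) y∉Dw xw e x≢y)
          -- `D v` can be entered from outside only through `v`, which `C` misses.
          y∉Dv : Location u → y ∉ D v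
          y∉Dv (inj₁ u∈Dw) y∈Dv with refl ← u≡w u∈Dw =
            w∉Dv (D-closed y∈Dv y≢v w∈V (edge-sym e))
          y∉Dv (inj₂ (u∈K , u∉Dv)) y∈Dv =
            u∉Dv (D-closed y∈Dv y≢v (X⊆V (K⊆X u∈K)) (edge-sym e))

        C⊆Dw∪K∖Dv : C ⊆ D w ∪ (K ∩ ∁ (D v))
        C⊆Dw∪K∖Dv u∈C with invariant Location preserved (conn w _ w∈C u∈C) (inj₁ (D-refl w∈X))
        ... | inj₁ u∈Dw = p⊆p∪q _ u∈Dw
        ... | inj₂ (u∈K , u∉Dv) = q⊆p∪q (D w) _ (x∈p∩q⁺ (u∈K , x∉p⇒x∈∁p u∉Dv))

  -- Choice of the shedding vertex.

  Exchangeable : Subset (n G) → Subset (n G) → Fin (n G) → Set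
  Exchangeable I V v = ∀ σ → I ⊆ σ → σ ⊆ V → v ∈ σ → Small σ →
    ∃ λ w → w ∈ V × w ∉ σ × Small ((σ - v) ∪ ⁅ w ⁆)

  module _ (blocks : BlocksAreCliques) where

    open VertexDecomposable (Ind G r) independent? independent-⊆

    shedding-vertex : ∀ {I V} → I ⊆ V → Small I → ¬ Small V →
      ∃ λ v → v ∈ V × v ∉ I × Exchangeable I V v
    shedding-vertex {I} {V} I⊆V I-small V-large with small-or-large V
    ... | inj₁ V-small = contradiction V-small V-large
    ... | inj₂ (C , C⊆V , C-conn , r<C) with nonempty? C
    ...   | no empty = contradiction (ℕₚ.<-≤-trans r<C (ℕₚ.≤-reflexive
                         (trans (cong ∣_∣ (Empty-unique empty)) (∣⊥∣≡0 (n G))))) λ ()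
    ...   | yes (ρ , ρ∈C) = choose (small-or-large (X ∩ ∁ Big))
      where
      X = component V ρ
      ρ∈X : ρ ∈ X
      ρ∈X = ∈-component⁺ (here (C⊆V ρ∈C))
      C⊆X : C ⊆ X
      C⊆X u∈C = ∈-component⁺ (walk-⊆ C⊆V (C-conn ρ _ ρ∈C u∈C))
      open Dominators blocks {V} {X} ρ component⊆ component-connected component-closed ρ∈X

      Big? : Decidable λ v → (v ∈ X × v ∉ I) × r < ∣ D v ∣
      Big? v = (v ∈? X ×-dec ¬? (v ∈? I)) ×-dec r <? ∣ D v ∣
      Big = ⟪ Big? ⟫

      unbig⇒∈I : ∀ {v} → v ∈ X → v ∉ Big → r < ∣ D v ∣ → v ∈ I
      unbig⇒∈I v∈X v∉Big r<Dv =
        decidable-stable (_ ∈? I) λ v∉I → v∉Big (∈⟪⟫⁺ Big? ((v∈X , v∉I) , r<Dv))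

      choose : (Small (X ∩ ∁ Big) ⊎ ∃ λ M → M ⊆ X ∩ ∁ Big × ConnectedIn G M × r < ∣ M ∣) →
        ∃ λ v → v ∈ V × v ∉ I × Exchangeable I V v
      choose (inj₂ (M , M⊆ , M-conn , r<M))
        -- `M` is connected with more than `r` vertices, so it is not contained in the face `I`.
        with u , u∈M , u∉I ← ⊈⇒∃ M I (λ M⊆I → ℕₚ.<⇒≱ r<M (I-small M M⊆I M-conn))
        with v , v∈ , largest ← maximum-on (λ v → ∣ D v ∣) (M ∩ ∁ I) (x∈p∩q⁺ (u∈M , x∉p⇒x∈∁p u∉I))
        = v , X⊆V v∈X , v∉I , exchange
        where
        X⊆V : X ⊆ V
        X⊆V = component⊆
        M⊆X : M ⊆ X
        M⊆X y∈M = p∩q⊆p X (∁ Big) (M⊆ y∈M)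
        v∈M = p∩q⊆p M (∁ I) v∈
        v∈X = M⊆X v∈M
        v∉I : v ∉ I
        v∉I = x∈∁p⇒x∉p (p∩q⊆q M (∁ I) v∈)
        Dv≤r : ∣ D v ∣ ≤ r
        Dv≤r = ℕₚ.≮⇒≥ λ r<Dv → v∉I (unbig⇒∈I v∈X (x∈∁p⇒x∉p (p∩q⊆q X (∁ Big) (M⊆ v∈M))) r<Dv)
        exchange : Exchangeable I V v
        exchange σ I⊆σ σ⊆V v∈σ small with D v ⊆? σ
        -- `D v` has at most `r` vertices, so all its subsets satisfy the bound.
        ... | no Dv⊈σ with w , w∈Dv , w∉σ ← ⊈⇒∃ (D v) σ Dv⊈σ =
          w , X⊆V (D⊆X w∈Dv) , w∉σ ,
          swap-below σ⊆V v∈σ small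
            (λ C C⊆ _ → ℕₚ.≤-trans (p⊆q⇒∣p∣≤∣q∣ (λ y∈ → p-x⊆p (D v) v (C⊆ y∈))) Dv≤r) w∈Dv w∉σ
        -- `M` is too large to lie in the component of `v` in `σ`, so a walk in `M` leaves that
        -- component along an edge from `x` to `w`. This `w` is not in `σ`, hence not in `I`, and
        -- `largest` compares it with `v`.
        ... | yes Dv⊆σ
          with z , z∈M , z∉K ← ⊈⇒∃ M (component σ v) (λ M⊆K → ℕₚ.<⇒≱ r<M
            (small M (λ y∈ → component⊆ (M⊆K y∈)) M-conn))
          with x , w , x∈K , w∈M , w∉K , xw ←
            exit (component σ v) (M-conn v z v∈M z∈M) (∈-component⁺ (here v∈σ)) z∉K
          with w∉σ ← (λ w∈σ → w∉K (component-closed x∈K w∈σ xw)) =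
          w , X⊆V (M⊆X w∈M) , w∉σ ,
          swap-across σ⊆V v∈σ v∈X small Dv⊆σ (X⊆V (M⊆X w∈M)) w∉σ x∈K xw
            (largest (x∈p∩q⁺ (w∈M , x∉p⇒x∈∁p (λ w∈I → w∉σ (I⊆σ w∈I)))))
      choose (inj₁ small-outside)
        -- If no vertex were big, the large connected set `C` would contradict `small-outside`.
        with u , u∈X , u∉ ← ⊈⇒∃ X (X ∩ ∁ Big) (λ X⊆ → ℕₚ.<⇒≱ r<C
          (small-outside C (λ y∈ → X⊆ (C⊆X y∈)) C-conn))
        with v , v∈Big , smallest ← minimum-on (λ v → ∣ D v ∣) Big
          (decidable-stable (u ∈? Big) λ u∉Big → u∉ (x∈p∩q⁺ (u∈X , x∉p⇒x∈∁p u∉Big)))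
        with (v∈X , v∉I) , r<Dv ← ∈⟪⟫⁻ Big? v∈Big
        = v , component⊆ v∈X , v∉I , exchange
        where
        -- A big `y` in `D v` other than `v` would have `D y` strictly inside `D v`, against the
        -- choice of `v`.
        below-small : Small (D v - v)
        below-small C C⊆ = small-outside C λ {y} y∈C → x∈p∩q⁺
          ( D⊆X (p-x⊆p (D v) v (C⊆ y∈C))
          , x∉p⇒x∈∁p λ y∈Big → ℕₚ.<⇒≱
              (D-shrinks (p-x⊆p (D v) v (C⊆ y∈C)) v∈X
                (D-antisym (x∈p-y⇒x≢y (D v) (C⊆ y∈C)) (p-x⊆p (D v) v (C⊆ y∈C))))
              (smallest y∈Big))
        exchange : Exchangeable I V v
        exchange σ I⊆σ σ⊆V v∈σ small
          -- `D v` is connected with more than `r` vertices, so no face contains it.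
          with w , w∈Dv , w∉σ ← ⊈⇒∃ (D v) σ (λ Dv⊆σ → ℕₚ.<⇒≱ r<Dv
            (small (D v) Dv⊆σ (D-connected v∈X)))
          = w , component⊆ (D⊆X w∈Dv) , w∉σ , swap-below σ⊆V v∈σ small below-small w∈Dv w∉σ

    Ind-shellable : Shellable (Ind G r)
    Ind-shellable = shellable λ {I} {V} I⊆V ΔI ¬ΔV →
      let v , v∈V , v∉I , exchange =
            shedding-vertex I⊆V (independent⇒small ΔI) (¬ΔV ∘ small⇒independent)
      in v , v∈V , v∉I , λ σ I⊆σ σ⊆V v∈σ Δσ →
        let w , w∈V , w∉σ , small = exchange σ I⊆σ σ⊆V v∈σ (independent⇒small Δσ)
        in w , w∈V , w∉σ , small⇒independent small

theorem4p15 : (G : Graph) → T2Graph G → Shellable (Ind G 4)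
theorem4p15 G t2 = HigherIndependence.Ind-shellable G 4
  λ W W-comp → proj₁ (proj₂ (t2 W W-comp))
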